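{- Let $p$ be a prime. There exist an infinite set $Q$ of powers of $p$ and, for each $q \in Q$, a subset $E_q \subseteq \mathbb{F}_q^2$ such that $|E_q| = q^{4/3}$ and $\Delta(E_q) \neq \mathbb{F}_q$. Moreover, these can be chosen so that $\limsup_{q \in Q,\, q \to \infty} |\Delta(E_q)|/q \leq 1/2$.
   Context: $\mathbb{F}_q$ denotes the finite field with $q$ elements. For $E \subseteq \mathbb{F}_q^2$, the distance set of $E$ is $\Delta(E) = \{ (x-y)\cdot(x-y) : x, y \in E\}$, where for $z=(z_1,z_2)\in\mathbb{F}_q^2$ one sets $z\cdot z = z_1^2+z_2^2$. -}

module Defs where

open import Level using (0ℓ)
open import Data.Nat using (ℕ)
open import Data.Fin using (Fin)
open import Data.Product using (Σ; _×_; _,_)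
open import Data.List using (List; length; cartesianProductWith; deduplicate)
open import Relation.Binary.PropositionalEquality using (_≡_; _≢_)
open import Relation.Binary.Definitions using (DecidableEquality)
open import Algebra.Structures using (IsCommutativeRing)
open import Function.Bundles using (_⤖_)

record FiniteField (q : ℕ) : Set₁ where
  field
    Carrier : Set
    _+_ _*_ : Carrier → Carrier → Carrier
    -_      : Carrier → Carrier
    0# 1#   : Carrier
    isCommutativeRing : IsCommutativeRing _≡_ _+_ _*_ -_ 0# 1#
    0≢1     : 0# ≢ 1#
    inverse : ∀ x → x ≢ 0# → Σ Carrier (λ y → (x * y) ≡ 1#)
    _≟_     : DecidableEquality Carrier
    enum    : Carrier ⤖ Fin q

  dot : Carrier × Carrier → Carrier
  dot (z₁ , z₂) = (z₁ * z₁) + (z₂ * z₂)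

  dist : Carrier × Carrier → Carrier × Carrier → Carrier
  dist (x₁ , x₂) (y₁ , y₂) = dot ((x₁ + (- y₁)) , (x₂ + (- y₂)))

  Δ : List (Carrier × Carrier) → List Carrier
  Δ E = deduplicate _≟_ (cartesianProductWith dist E E)

  ∣Δ∣ : List (Carrier × Carrier) → ℕ
  ∣Δ∣ E = length (Δ E)

{-# OPTIONS --safe #-}
module Submission where

-- Take q = r³ with r = p^(2n), let K be the subfield of order r, and let V = K + Kα be a
-- two-dimensional K-subspace of F_q.  E = V × V has r⁴ = q^(4/3) elements.  As r is an even
-- power of p, K contains i with i² = -1 (i = 1 if p = 2), so every distance factors as
-- x² + y² = (x + iy)(x - iy), a product of two elements of V.  Each element of V is a K-multiple
-- of one of r + 1 representatives of the lines of V, and by commutativity the order of the two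
-- representatives is irrelevant; hence |Δ(E)| ≤ r · (r+1)(r+2)/2 ~ q/2.
--
-- The subfield is the fixed set of φ(x) = x^r.  It has at most r elements, being the roots of a
-- polynomial of degree r; and φ - id has image in the zeros of x + x^r + x^(r²), of which there
-- are at most r², so its kernel has at least r elements.

open import Level using (0ℓ)
open import Algebra.Bundles using (CommutativeRing; RawMonoid)
open import Algebra.Structures using (IsCommutativeMonoid)
import Algebra.Definitions.RawMonoid as RawMonoidDefinitions
import Algebra.Properties.CommutativeMonoid.Sum as Sum
import Algebra.Properties.CommutativeSemiring.Binomial as Binomial
import Algebra.Properties.CommutativeSemiring.Exp as Exp
import Algebra.Properties.Group as GroupProperties
import Algebra.Properties.Ring as RingProperties
import Algebra.Properties.Semiring.Mult as Mult
import Algebra.Solver.Ring.NaturalCoefficients.Default as SemiringSolver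
open import Data.Fin as Fin using (Fin; toℕ; fromℕ; inject₁)
open import Data.Fin.Properties using (toℕ-fromℕ; toℕ-inject₁; toℕ<n)
open import Data.List using (List; []; _∷_; _++_; length; map; foldr; filter; replicate; tabulate; cartesianProduct; cartesianProductWith)
open import Data.List.Properties using (length-map; length-++; length-tabulate; length-replicate)
open import Data.List.Membership.Propositional using (_∈_; find)
open import Data.List.Membership.Propositional.Properties
open import Data.List.Relation.Binary.Permutation.Propositional using (_↭_; ↭-trans; ↭-reflexive; prep; ↭⇒↭ₛ)
open import Data.List.Relation.Binary.Permutation.Propositional.Properties using (shift; ↭-length; ++-identityʳ)
open import Data.List.Relation.Binary.Permutation.Setoid.Properties using (foldr-commMonoid)
open import Data.List.Relation.Binary.Subset.Propositional using (_⊆_)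
open import Data.List.Relation.Unary.All as All using (All; []; _∷_)
open import Data.List.Relation.Unary.All.Properties using (¬All⇒Any¬) renaming (map⁺ to All-map⁺)
open import Data.List.Relation.Unary.AllPairs using ([]; _∷_)
open import Data.List.Relation.Unary.Any as Any using (Any; here; there)
open import Data.List.Relation.Unary.Unique.Propositional using (Unique)
import Data.List.Relation.Unary.Unique.Propositional.Properties as Unique
open import Data.List.Relation.Unary.Unique.DecPropositional.Properties using (deduplicate-!)
open import Data.Nat as ℕ using (ℕ; zero; suc; z≤n; s≤s; _!; _∸_)
open import Data.Nat.Combinatorics using (_C_; nCk≡n!/k![n-k]!; nCn≡1; k![n∸k]!∣n!)
open import Data.Nat.Divisibility using (_∣_; divides; m∣m*n; ∣⇒≤; ∣1⇒≡1)
open import Data.Nat.DivMod using (m/n*n≡m; m≡m%n+[m/n]*n; m%n<n)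
open import Data.Nat.Primality using (Prime; euclidsLemma; prime⇒nonZero; prime⇒nonTrivial; prime⇒irreducible)
import Data.Nat.Properties as ℕ
import Data.Nat.Tactic.RingSolver as ℕ-Solver
open import Data.Product using (Σ; ∃; ∃₂; _×_; _,_; proj₁; proj₂)
open import Data.Sum using (_⊎_; inj₁; inj₂)
open import Function using (_∘_; case_of_)
open import Function.Bundles using (Bijection)
open import Relation.Binary.PropositionalEquality
open import Relation.Nullary using (¬_; Dec; yes; no; ¬?; contradiction)

open import Defs

-- Counting with duplicate-free lists.

module _ {a} {A : Set a} where

  -- Deleting one occurrence of x from `ys` keeps the tail of `xs` included, since x does not recur
  -- there. Repetitions in `ys` simply end up in the leftover list.
  Unique-⊆⇒↭ : {xs ys : List A} → Unique xs → xs ⊆ ys → ∃ λ zs → ys ↭ xs ++ zs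
  Unique-⊆⇒↭ {[]} {ys} _ _ = ys , ↭-reflexive refl
  Unique-⊆⇒↭ {x ∷ xs} (x≢xs ∷ xs!) x∷xs⊆ys with ∈-∃++ (x∷xs⊆ys (here refl))
  ... | as , bs , refl = zs , ↭-trans (shift x as bs) (prep x as++bs↭)
    where
    xs⊆as++bs : xs ⊆ as ++ bs
    xs⊆as++bs {z} z∈xs with ∈-++⁻ as (x∷xs⊆ys (there z∈xs))
    ... | inj₁ z∈as = ∈-++⁺ˡ z∈as
    ... | inj₂ (here refl) = contradiction refl (All.lookup x≢xs z∈xs)
    ... | inj₂ (there z∈bs) = ∈-++⁺ʳ as z∈bs

    rest = Unique-⊆⇒↭ xs! xs⊆as++bs
    zs = proj₁ rest
    as++bs↭ = proj₂ rest

  Unique-⊆⇒length-≤ : {xs ys : List A} → Unique xs → xs ⊆ ys → length xs ℕ.≤ length ys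
  Unique-⊆⇒length-≤ {xs} xs! xs⊆ys with zs , ys↭ ← Unique-⊆⇒↭ xs! xs⊆ys =
    subst (length xs ℕ.≤_) (sym (trans (↭-length ys↭) (length-++ xs))) (ℕ.m≤m+n _ _)

  -- Equal lengths leave nothing over. This is the pigeonhole principle by which an injective
  -- self-map of a finite set permutes it.
  Unique-⊆-length⇒↭ : {xs ys : List A} → Unique xs → xs ⊆ ys → length xs ≡ length ys → ys ↭ xs
  Unique-⊆-length⇒↭ {xs} xs! xs⊆ys eq with Unique-⊆⇒↭ xs! xs⊆ys
  ... | [] , ys↭ = ↭-trans ys↭ (++-identityʳ xs)
  ... | z ∷ zs , ys↭ = contradiction
    (trans eq (trans (↭-length ys↭) (length-++ xs)))
    (ℕ.<⇒≢ (ℕ.m<m+n (length xs) (s≤s z≤n)))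

  unorderedPairs : List A → List (A × A)
  unorderedPairs [] = []
  unorderedPairs (x ∷ xs) = map (x ,_) (x ∷ xs) ++ unorderedPairs xs

  -- A triangular number, the diagonal being included; doubled to avoid division. The factor 1/2 of
  -- the theorem comes from here.
  length-unorderedPairs : ∀ xs → 2 ℕ.* length (unorderedPairs xs) ≡ length xs ℕ.* suc (length xs)
  length-unorderedPairs [] = refl
  length-unorderedPairs (x ∷ xs) = begin
    2 ℕ.* length (unorderedPairs (x ∷ xs))
      ≡⟨ cong (2 ℕ.*_) (trans (length-++ (map (x ,_) (x ∷ xs))) (cong (ℕ._+ length (unorderedPairs xs)) (length-map (x ,_) (x ∷ xs)))) ⟩
    2 ℕ.* (suc n ℕ.+ length (unorderedPairs xs))
      ≡⟨ ℕ.*-distribˡ-+ 2 (suc n) _ ⟩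
    2 ℕ.* suc n ℕ.+ 2 ℕ.* length (unorderedPairs xs)
      ≡⟨ cong (2 ℕ.* suc n ℕ.+_) (length-unorderedPairs xs) ⟩
    2 ℕ.* suc n ℕ.+ n ℕ.* suc n
      ≡⟨ ℕ.*-distribʳ-+ (suc n) 2 n ⟨
    (2 ℕ.+ n) ℕ.* suc n
      ≡⟨ ℕ.*-comm (2 ℕ.+ n) (suc n) ⟩
    suc n ℕ.* suc (suc n) ∎
    where
    open ≡-Reasoning
    n = length xs

  ∈-unorderedPairs : ∀ {xs x y} → x ∈ xs → y ∈ xs →
                     (x , y) ∈ unorderedPairs xs ⊎ (y , x) ∈ unorderedPairs xs
  ∈-unorderedPairs (here refl) y∈ = inj₁ (∈-++⁺ˡ (∈-map⁺ _ y∈))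
  ∈-unorderedPairs (there x∈) (here refl) = inj₂ (∈-++⁺ˡ (∈-map⁺ _ (there x∈)))
  ∈-unorderedPairs {z ∷ zs} (there x∈) (there y∈) with ∈-unorderedPairs x∈ y∈
  ... | inj₁ xy∈ = inj₁ (∈-++⁺ʳ (map (z ,_) (z ∷ zs)) xy∈)
  ... | inj₂ yx∈ = inj₂ (∈-++⁺ʳ (map (z ,_) (z ∷ zs)) yx∈)

-- Injectivity is asked on the entries only, because (s , t) ↦ s + tα will be injective on pairs
-- from the subfield but not on all pairs.
Unique-map : ∀ {a b} {A : Set a} {B : Set b} (f : A → B) {xs} → Unique xs →
             (∀ {x y} → x ∈ xs → y ∈ xs → f x ≡ f y → x ≡ y) → Unique (map f xs)
Unique-map f [] _ = []
Unique-map f (x≢xs ∷ xs!) inj =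
  All-map⁺ (All.tabulate λ y∈ fx≡fy → All.lookup x≢xs y∈ (inj (here refl) (there y∈) fx≡fy)) ∷
  Unique-map f xs! (λ x∈ y∈ → inj (there x∈) (there y∈))

length-cartesianProductWith : ∀ {a b c} {A : Set a} {B : Set b} {C : Set c} (f : A → B → C) xs ys →
                              length (cartesianProductWith f xs ys) ≡ length xs ℕ.* length ys
length-cartesianProductWith f [] ys = refl
length-cartesianProductWith f (x ∷ xs) ys = trans (length-++ (map (f x) ys))
  (cong₂ ℕ._+_ (length-map (f x) ys) (length-cartesianProductWith f xs ys))

-- Translations of a finite subset of a commutative monoid.

module _ {A : Set} {_∙_ : A → A → A} {ε : A} (M : IsCommutativeMonoid _≡_ _∙_ ε) where
  open IsCommutativeMonoid M using (assoc; comm; identityˡ)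

  private
    rawMonoid : RawMonoid 0ℓ 0ℓ
    rawMonoid = record { Carrier = A ; _≈_ = _≡_ ; _∙_ = _∙_ ; ε = ε }

  open RawMonoidDefinitions rawMonoid using () renaming (_×_ to _·_)

  private
    fold : List A → A
    fold = foldr _∙_ ε

  -- Kept at the level of monoids so as to serve twice: `n · g` is a multiple for addition and a
  -- power for multiplication.
  fold-translate : ∀ g xs → fold (map (g ∙_) xs) ≡ (length xs · g) ∙ fold xs
  fold-translate g [] = sym (identityˡ ε)
  fold-translate g (x ∷ xs) = begin
    (g ∙ x) ∙ fold (map (g ∙_) xs)  ≡⟨ cong ((g ∙ x) ∙_) (fold-translate g xs) ⟩
    (g ∙ x) ∙ (n·g ∙ fold xs)       ≡⟨ assoc g x _ ⟩
    g ∙ (x ∙ (n·g ∙ fold xs))       ≡⟨ cong (g ∙_) (assoc x n·g _) ⟨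
    g ∙ ((x ∙ n·g) ∙ fold xs)       ≡⟨ cong (λ z → g ∙ (z ∙ fold xs)) (comm x n·g) ⟩
    g ∙ ((n·g ∙ x) ∙ fold xs)       ≡⟨ cong (g ∙_) (assoc n·g x _) ⟩
    g ∙ (n·g ∙ (x ∙ fold xs))       ≡⟨ assoc g n·g _ ⟨
    (g ∙ n·g) ∙ (x ∙ fold xs)       ∎
    where
    open ≡-Reasoning
    n·g = length xs · g

  -- Translation by g permutes xs, so both sides are the product of g ∙ x over x ∈ xs.
  fold-invariant : ∀ g xs → Unique xs → (∀ {x y} → g ∙ x ≡ g ∙ y → x ≡ y) →
                   (∀ {x} → x ∈ xs → (g ∙ x) ∈ xs) → (length xs · g) ∙ fold xs ≡ fold xs
  fold-invariant g xs xs! inj closed = trans (sym (fold-translate g xs))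
    (sym (foldr-commMonoid (setoid A) M (↭⇒↭ₛ (Unique-⊆-length⇒↭ (Unique.map⁺ inj xs!) ⊆xs (length-map _ xs)))))
    where
    ⊆xs : map (g ∙_) xs ⊆ xs
    ⊆xs z∈ with x , x∈ , refl ← ∈-map⁻ _ z∈ = closed x∈

-- Divisibility of binomial coefficients by a prime.

prime∤! : ∀ {p} → Prime p → ∀ {m} → m ℕ.< p → ¬ (p ∣ m !)
prime∤! {p} pp {zero} _ p∣1 = ℕ.nonTrivial⇒≢1 {{prime⇒nonTrivial pp}} (∣1⇒≡1 p∣1)
prime∤! pp {suc m} m<p p∣ with euclidsLemma (suc m) (m !) pp p∣
... | inj₁ p∣1+m = ℕ.<⇒≱ m<p (∣⇒≤ p∣1+m)
... | inj₂ p∣m! = prime∤! pp (ℕ.<-trans (ℕ.n<1+n m) m<p) p∣m!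

-- p divides p! = C(p,k) k! (p-k)!, but neither of the two factorials, all of whose factors are
-- below p.
prime∣C : ∀ {p} → Prime p → ∀ {k} → 0 ℕ.< k → k ℕ.< p → p ∣ p C k
prime∣C {p} pp {k} 0<k k<p = case euclidsLemma (p C k) _ pp p∣product of λ where
    (inj₁ p∣C) → p∣C
    (inj₂ p∣k![p-k]!) → case euclidsLemma (k !) ((p ∸ k) !) pp p∣k![p-k]! of λ where
      (inj₁ p∣k!) → contradiction p∣k! (prime∤! pp k<p)
      (inj₂ p∣[p-k]!) → contradiction p∣[p-k]! (prime∤! pp (ℕ.∸-monoʳ-< 0<k (ℕ.<⇒≤ k<p)))
  where
  instance
    _ = prime⇒nonZero pp
    _ = k ℕ.!* (p ∸ k) !≢0

  p∣p! : ∀ n → .{{ℕ.NonZero n}} → n ∣ n !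
  p∣p! (suc n) = m∣m*n (n !)

  p∣product : p ∣ (p C k) ℕ.* (k ! ℕ.* (p ∸ k) !)
  p∣product = subst (p ∣_) (sym (trans (cong (ℕ._* (k ! ℕ.* (p ∸ k) !)) (nCk≡n!/k![n-k]! (ℕ.<⇒≤ k<p)))
    (m/n*n≡m (k![n∸k]!∣n! (ℕ.<⇒≤ k<p))))) (p∣p! p)

-- Finite fields: cancellation and roots of polynomials.

module FieldProperties {q} (F : FiniteField q) where
  open FiniteField F using (Carrier; _≟_; isCommutativeRing; 0≢1; inverse; enum)

  commutativeRing : CommutativeRing 0ℓ 0ℓ
  commutativeRing = record { isCommutativeRing = isCommutativeRing }

  open CommutativeRing commutativeRing public
    using (_+_; _*_; -_; _-_; 0#; 1#; +-comm; *-assoc; *-comm; +-identityˡ; +-identityʳ; *-identityˡ; *-identityʳ; zeroˡ; zeroʳ;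
           -‿inverseˡ; -‿inverseʳ; distribˡ; distribʳ; ring; semiring; commutativeSemiring; +-group;
           +-isCommutativeMonoid; *-isCommutativeMonoid; +-commutativeMonoid)
  open RingProperties ring public using (-‿distribˡ-*; -‿distribʳ-*; -‿involutive)
  open GroupProperties +-group public using () renaming
    (∙-cancelˡ to +-cancelˡ; ∙-cancelʳ to +-cancelʳ; x∙y⁻¹≈ε⇒x≈y to x-y≡0⇒x≡y; inverseʳ-unique to neg-uniqueʳ; //-rightDividesˡ to [x-y]+y≡x)
  open Exp commutativeSemiring public using (^-distrib-*)
  open import Algebra.Properties.Semiring.Exp semiring public using (_^_; ^-homo-*; ^-assocʳ)
  open Mult semiring public using (×1-homo-*; ×-assoc-*) renaming (_×_ to _·_)
  open SemiringSolver commutativeSemiring public using (solve; _:=_; _:+_; _:*_)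

  private
    enumFrom : Fin q → Carrier
    enumFrom = proj₁ ∘ Bijection.strictlySurjective enum

    enumTo-from : ∀ i → Bijection.to enum (enumFrom i) ≡ i
    enumTo-from = proj₂ ∘ Bijection.strictlySurjective enum

  elements : List Carrier
  elements = tabulate enumFrom

  length-elements : length elements ≡ q
  length-elements = length-tabulate enumFrom

  ∈-elements : ∀ x → x ∈ elements
  ∈-elements x = subst (_∈ elements) (Bijection.injective enum (enumTo-from _)) (∈-tabulate⁺ (Bijection.to enum x))

  elements-Unique : Unique elements
  elements-Unique = Unique.tabulate⁺ λ {i} {j} eq →
    trans (sym (enumTo-from i)) (trans (cong (Bijection.to enum) eq) (enumTo-from j))

  1≢0 : 1# ≢ 0#
  1≢0 = 0≢1 ∘ sym

  _⁻¹⟨_⟩ : ∀ x → x ≢ 0# → Carrier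
  x ⁻¹⟨ x≢0 ⟩ = proj₁ (inverse x x≢0)

  *-inverse : ∀ x (x≢0 : x ≢ 0#) → x * (x ⁻¹⟨ x≢0 ⟩) ≡ 1#
  *-inverse x x≢0 = proj₂ (inverse x x≢0)

  *-cancelˡ : ∀ {x} → x ≢ 0# → ∀ {y z} → x * y ≡ x * z → y ≡ z
  *-cancelˡ {x} x≢0 {y} {z} eq = begin
    y              ≡⟨ *-identityˡ y ⟨
    1# * y         ≡⟨ cong (_* y) x⁻¹x ⟨
    (x⁻¹ * x) * y  ≡⟨ *-assoc x⁻¹ x y ⟩
    x⁻¹ * (x * y)  ≡⟨ cong (x⁻¹ *_) eq ⟩
    x⁻¹ * (x * z)  ≡⟨ *-assoc x⁻¹ x z ⟨
    (x⁻¹ * x) * z  ≡⟨ cong (_* z) x⁻¹x ⟩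
    1# * z         ≡⟨ *-identityˡ z ⟩
    z              ∎
    where
    open ≡-Reasoning
    x⁻¹ = x ⁻¹⟨ x≢0 ⟩
    x⁻¹x : x⁻¹ * x ≡ 1#
    x⁻¹x = trans (*-comm _ x) (*-inverse x x≢0)

  x≢0∧xy≡0⇒y≡0 : ∀ {x y} → x ≢ 0# → x * y ≡ 0# → y ≡ 0#
  x≢0∧xy≡0⇒y≡0 {x} x≢0 eq = *-cancelˡ x≢0 (trans eq (sym (zeroʳ x)))

  *-≢0 : ∀ {x y} → x ≢ 0# → y ≢ 0# → x * y ≢ 0#
  *-≢0 x≢0 y≢0 eq = y≢0 (x≢0∧xy≡0⇒y≡0 x≢0 eq)

  1^n≡1 : ∀ n → 1# ^ n ≡ 1#
  1^n≡1 zero = refl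
  1^n≡1 (suc n) = trans (*-identityˡ _) (1^n≡1 n)

  x^n≡0⇒x≡0 : ∀ {x} n → x ^ n ≡ 0# → x ≡ 0#
  x^n≡0⇒x≡0 zero eq = contradiction eq 1≢0
  x^n≡0⇒x≡0 {x} (suc n) eq with x ≟ 0#
  ... | yes x≡0 = x≡0
  ... | no x≢0 = x^n≡0⇒x≡0 n (x≢0∧xy≡0⇒y≡0 x≢0 eq)

  -- The only form in which `CubicExtension` needs the characteristic.
  AdditivePower : ℕ → Set
  AdditivePower n = ∀ x y → (x + y) ^ n ≡ x ^ n + y ^ n

  -- Monic polynomials, given by their non-leading coefficients from the constant term upwards.
  monic : List Carrier → Carrier → Carrier
  monic [] x = 1#
  monic (c ∷ cs) x = c + x * monic cs x

  -- Synthetic division by Horner's scheme: the coefficients are the values at a of the successive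
  -- tails. If f is the polynomial of `cs`, the result is (X f(X) - a f(a)) / (X - a), which is also
  -- the quotient of any c + X f(X) by X - a.
  quotient : Carrier → List Carrier → List Carrier
  quotient a [] = []
  quotient a (c ∷ cs) = monic (c ∷ cs) a ∷ quotient a cs

  length-quotient : ∀ a cs → length (quotient a cs) ≡ length cs
  length-quotient a [] = refl
  length-quotient a (c ∷ cs) = cong suc (length-quotient a cs)

  monic-quotient : ∀ a cs x → x * monic cs x ≡ (x - a) * monic (quotient a cs) x + a * monic cs a
  monic-quotient a [] x = begin
    x * 1#                   ≡⟨ cong (_* 1#) ([x-y]+y≡x a x) ⟨
    ((x - a) + a) * 1#       ≡⟨ distribʳ 1# (x - a) a ⟩
    (x - a) * 1# + a * 1#    ∎
    where open ≡-Reasoning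
  monic-quotient a (c ∷ cs) x = begin
    x * (c + x * monic cs x)
      ≡⟨ cong (λ z → x * (c + z)) (monic-quotient a cs x) ⟩
    x * (c + (D * Q + a * m))
      -- With x written as `D + a` no subtraction is left, so the semiring solver applies.
      ≡⟨ cong (_* (c + (D * Q + a * m))) ([x-y]+y≡x a x) ⟨
    (D + a) * (c + (D * Q + a * m))
      ≡⟨ solve 5 (λ D a c Q m → (D :+ a) :* (c :+ (D :* Q :+ a :* m)) := D :* ((c :+ a :* m) :+ (D :+ a) :* Q) :+ a :* (c :+ a :* m)) refl D a c Q m ⟩
    D * ((c + a * m) + (D + a) * Q) + a * (c + a * m)
      ≡⟨ cong (λ z → D * ((c + a * m) + z * Q) + a * (c + a * m)) ([x-y]+y≡x a x) ⟩
    D * ((c + a * m) + x * Q) + a * (c + a * m) ∎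
    where
    open ≡-Reasoning
    D = x - a
    Q = monic (quotient a cs) x
    m = monic cs a

  -- Divide by X - a for the first root a. Any other root is a root of the quotient, because x - a
  -- is nonzero and can be cancelled.
  length-roots≤degree : ∀ cs xs → Unique xs → All (λ x → monic cs x ≡ 0#) xs → length xs ℕ.≤ length cs
  length-roots≤degree cs xs = go (length cs) cs refl xs
    where
    -- The degree is a separate argument, as `quotient a cs` is not a structural part of `c ∷ cs`.
    go : ∀ n cs → length cs ≡ n → ∀ xs → Unique xs → All (λ x → monic cs x ≡ 0#) xs → length xs ℕ.≤ n
    go n cs _ [] _ _ = z≤n
    go n [] _ (a ∷ xs) _ (1≡0 ∷ _) = contradiction 1≡0 1≢0
    go (suc n) (c ∷ cs) eq (a ∷ xs) (a≢xs ∷ xs!) (fa≡0 ∷ fxs≡0) =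
      s≤s (go n (quotient a cs) (trans (length-quotient a cs) (ℕ.suc-injective eq)) xs xs!
        (All.zipWith quotient-root (a≢xs , fxs≡0)))
      where
      open ≡-Reasoning
      quotient-root : ∀ {x} → a ≢ x × monic (c ∷ cs) x ≡ 0# → monic (quotient a cs) x ≡ 0#
      quotient-root {x} (a≢x , fx≡0) = x≢0∧xy≡0⇒y≡0 (a≢x ∘ sym ∘ x-y≡0⇒x≡y x a) (+-cancelʳ (a * monic cs a) _ _ (begin
        (x - a) * monic (quotient a cs) x + a * monic cs a  ≡⟨ monic-quotient a cs x ⟨
        x * monic cs x    ≡⟨ +-cancelˡ c _ _ (trans fx≡0 (sym fa≡0)) ⟩
        a * monic cs a    ≡⟨ +-identityˡ _ ⟨
        0# + a * monic cs a ∎))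

  monic-0s++ : ∀ n cs x → monic (replicate n 0# ++ cs) x ≡ x ^ n * monic cs x
  monic-0s++ zero cs x = sym (*-identityˡ _)
  monic-0s++ (suc n) cs x = trans (+-identityˡ _) (trans (cong (x *_) (monic-0s++ n cs x)) (sym (*-assoc x _ _)))

  monic-0s : ∀ n x → monic (replicate n 0#) x ≡ x ^ n
  monic-0s zero x = refl
  monic-0s (suc n) x = trans (+-identityˡ _) (cong (x *_) (monic-0s n x))

  -- The additive and multiplicative groups; a square root of -1.

  -- Translation by x permutes the field, so adding q · x does not change the sum of all elements.
  q·x≡0 : ∀ x → q · x ≡ 0#
  q·x≡0 x = subst (λ n → n · x ≡ 0#) length-elements
    (+-cancelʳ (foldr _+_ 0# elements) _ _ (trans
      (fold-invariant +-isCommutativeMonoid x elements elements-Unique (+-cancelˡ x _ _) (λ _ → ∈-elements _))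
      (sym (+-identityˡ _))))

  nonzeros : List Carrier
  nonzeros = filter (λ x → ¬? (x ≟ 0#)) elements

  nonzeros-Unique : Unique nonzeros
  nonzeros-Unique = Unique.filter⁺ _ elements-Unique

  ∈-nonzeros : ∀ {x} → x ≢ 0# → x ∈ nonzeros
  ∈-nonzeros x≢0 = ∈-filter⁺ _ (∈-elements _) x≢0

  nonzero : ∀ {x} → x ∈ nonzeros → x ≢ 0#
  nonzero x∈ = proj₂ (∈-filter⁻ (λ x → ¬? (x ≟ 0#)) {xs = elements} x∈)

  length-nonzeros : suc (length nonzeros) ≡ q
  length-nonzeros = trans (ℕ.≤-antisym
      (Unique-⊆⇒length-≤ (All.tabulate (λ x∈ 0≡x → nonzero x∈ (sym 0≡x)) ∷ nonzeros-Unique) (λ _ → ∈-elements _))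
      (Unique-⊆⇒length-≤ elements-Unique ⊆0∷nonzeros))
    length-elements
    where
    ⊆0∷nonzeros : elements ⊆ 0# ∷ nonzeros
    ⊆0∷nonzeros {x} _ with x ≟ 0#
    ... | yes x≡0 = here x≡0
    ... | no x≢0 = there (∈-nonzeros x≢0)

  -- The same argument in the multiplicative group: the product of the nonzero elements is itself
  -- nonzero and cancels.
  x^[q-1]≡1 : ∀ {x} → x ≢ 0# → x ^ length nonzeros ≡ 1#
  x^[q-1]≡1 {x} x≢0 = *-cancelˡ (product≢0 nonzeros nonzero) (trans (*-comm _ _) (trans
      (fold-invariant *-isCommutativeMonoid x nonzeros nonzeros-Unique (*-cancelˡ x≢0)
        (λ y∈ → ∈-nonzeros (*-≢0 x≢0 (nonzero y∈))))
      (sym (*-identityʳ _))))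
    where
    product≢0 : ∀ xs → (∀ {y} → y ∈ xs → y ≢ 0#) → foldr _*_ 1# xs ≢ 0#
    product≢0 [] _ = 1≢0
    product≢0 (y ∷ ys) ≢0 = *-≢0 (≢0 (here refl)) (product≢0 ys (≢0 ∘ there))

  x^q≡x : ∀ x → x ^ q ≡ x
  x^q≡x x = subst (λ n → x ^ n ≡ x) length-nonzeros x*x^[q-1]≡x
    where
    x*x^[q-1]≡x : x * x ^ length nonzeros ≡ x
    x*x^[q-1]≡x with x ≟ 0#
    ... | yes refl = zeroˡ _
    ... | no x≢0 = trans (cong (x *_) (x^[q-1]≡1 x≢0)) (*-identityʳ x)

  -- Some x ≢ 0 has y = x^((q-1)/2) ≢ 1, as y - 1 has too few roots in x; since y² = 1 this forces y = -1.
  √-1 : ∀ t → q ≡ suc (4 ℕ.* suc t) → ∃ λ i → i * i ≡ - 1#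
  √-1 t q≡ with All.all? (λ x → (x ^ (2 ℕ.* suc t)) ≟ 1#) nonzeros
  ... | yes all = contradiction (length-roots≤degree (- 1# ∷ replicate n 0#) nonzeros nonzeros-Unique (All.map root all))
        (ℕ.<⇒≱ (subst₂ ℕ._<_ (cong suc (sym (length-replicate n))) (ℕ.suc-injective (sym (trans length-nonzeros q≡)))
          (ℕ.*-monoˡ-< (suc t) {2} {4} (s≤s (s≤s (s≤s z≤n))))))
    where
    -- Chosen so that `2 ℕ.* suc t` reduces to `suc n`; the polynomial below is then X^((q-1)/2) -
    -- 1.
    n = t ℕ.+ 1 ℕ.* suc t
    root : ∀ {x} → x ^ suc n ≡ 1# → monic (- 1# ∷ replicate n 0#) x ≡ 0#
    root {x} eq = trans (cong (λ z → - 1# + x * z) (monic-0s n x)) (trans (cong (- 1# +_) eq) (-‿inverseˡ 1#))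
  ... | no ¬all with find (¬All⇒Any¬ (λ x → (x ^ (2 ℕ.* suc t)) ≟ 1#) nonzeros ¬all)
  ...   | x , x∈ , y≢1 = x ^ suc t , trans x^t*x^t≡y (neg-uniqueʳ 1# y
          (trans (+-comm 1# y) (x≢0∧xy≡0⇒y≡0 (y≢1 ∘ x-y≡0⇒x≡y y 1#) [y-1][y+1]≡0)))
    where
    open ≡-Reasoning
    y = x ^ (2 ℕ.* suc t)

    x^t*x^t≡y : x ^ suc t * x ^ suc t ≡ y
    x^t*x^t≡y = trans (sym (^-homo-* x (suc t) (suc t))) (cong (λ n → x ^ (suc t ℕ.+ n)) (sym (ℕ.*-identityˡ (suc t))))

    2n+2n≡4n : ∀ n → 2 ℕ.* n ℕ.+ 2 ℕ.* n ≡ 4 ℕ.* n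
    2n+2n≡4n n = sym (ℕ.*-distribʳ-+ n 2 2)

    y*y≡1 : y * y ≡ 1#
    y*y≡1 = begin
      y * y                  ≡⟨ ^-homo-* x (2 ℕ.* suc t) _ ⟨
      x ^ (2 ℕ.* suc t ℕ.+ 2 ℕ.* suc t) ≡⟨ cong (x ^_) (trans (2n+2n≡4n (suc t)) (ℕ.suc-injective (sym (trans length-nonzeros q≡)))) ⟩
      x ^ length nonzeros    ≡⟨ x^[q-1]≡1 (nonzero x∈) ⟩
      1#                     ∎

    [y-1][y+1]≡0 : (y - 1#) * (y + 1#) ≡ 0#
    [y-1][y+1]≡0 = begin
      -- The semiring solver knows no negation: -1 enters as a variable m, and 1 - 1 is cancelled
      -- afterwards.
      (y - 1#) * (y + 1#)                    ≡⟨ solve 3 (λ y m o → (y :+ m) :* (y :+ o) := (y :* y :+ m :* o) :+ (o :+ m) :* y) refl y (- 1#) 1# ⟩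
      (y * y + - 1# * 1#) + (1# - 1#) * y    ≡⟨ cong₂ _+_ (cong₂ _+_ y*y≡1 (*-identityʳ _)) (cong (_* y) (-‿inverseʳ 1#)) ⟩
      (1# - 1#) + 0# * y                     ≡⟨ cong₂ _+_ (-‿inverseʳ 1#) (zeroˡ y) ⟩
      0# + 0#                                ≡⟨ +-identityˡ 0# ⟩
      0#                                     ∎

-- Characteristic p and the Frobenius map.

module Characteristic {q} (F : FiniteField q) {p} (p-prime : Prime p) {k} (q≡p^k : q ≡ p ℕ.^ k) where
  open FieldProperties F public
  open Sum +-commutativeMonoid using (sum; sum-cong-≗; sum-replicate-zero; sum-init-last)

  [m^n]·1≡[m·1]^n : ∀ m n → (m ℕ.^ n) · 1# ≡ (m · 1#) ^ n
  [m^n]·1≡[m·1]^n m zero = +-identityʳ 1#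
  [m^n]·1≡[m·1]^n m (suc n) = trans (×1-homo-* m (m ℕ.^ n)) (cong ((m · 1#) *_) ([m^n]·1≡[m·1]^n m n))

  -- (p · 1)^k = q · 1 = 0, and a field has no nilpotents.
  p·1≡0 : p · 1# ≡ 0#
  p·1≡0 = x^n≡0⇒x≡0 k (trans (sym ([m^n]·1≡[m·1]^n p k)) (trans (cong (_· 1#) (sym q≡p^k)) (q·x≡0 1#)))

  p∣n⇒n·x≡0 : ∀ {n} → p ∣ n → ∀ x → n · x ≡ 0#
  p∣n⇒n·x≡0 (divides m refl) x = begin
    (m ℕ.* p) · x          ≡⟨ cong ((m ℕ.* p) ·_) (*-identityˡ x) ⟨
    (m ℕ.* p) · (1# * x)   ≡⟨ ×-assoc-* (m ℕ.* p) 1# x ⟨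
    ((m ℕ.* p) · 1#) * x   ≡⟨ cong (_* x) (×1-homo-* m p) ⟩
    (m · 1# * p · 1#) * x  ≡⟨ cong (λ z → (m · 1# * z) * x) p·1≡0 ⟩
    (m · 1# * 0#) * x      ≡⟨ cong (_* x) (zeroʳ _) ⟩
    0# * x                 ≡⟨ zeroˡ x ⟩
    0#                     ∎
    where open ≡-Reasoning

  -- In the binomial expansion all coefficients but the outer two are divisible by p.
  frobenius : AdditivePower p
  frobenius x y = go p refl
    where
    open ≡-Reasoning
    open Binomial commutativeSemiring using (binomialTerm; theorem)
    -- Replacing p by a variable allows matching on `suc n`, which exposes both end terms of the
    -- sum.
    go : ∀ n → n ≡ p → (x + y) ^ n ≡ x ^ n + y ^ n
    go zero refl with () ← prime⇒nonZero p-prime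
    go (suc n) refl = begin
      (x + y) ^ suc n                 ≡⟨ theorem (suc n) x y ⟩
      term Fin.zero + sum (term ∘ Fin.suc)
        ≡⟨ cong₂ _+_ first (sum-init-last (term ∘ Fin.suc)) ⟩
      y ^ suc n + (sum (λ i → term (Fin.suc (inject₁ i))) + term (Fin.suc (fromℕ n)))
        ≡⟨ cong (λ z → y ^ suc n + (z + term (Fin.suc (fromℕ n)))) (trans (sum-cong-≗ middle) (sum-replicate-zero n)) ⟩
      y ^ suc n + (0# + term (Fin.suc (fromℕ n)))
        ≡⟨ cong (y ^ suc n +_) (trans (+-identityˡ _) last) ⟩
      y ^ suc n + x ^ suc n           ≡⟨ +-comm _ _ ⟩
      x ^ suc n + y ^ suc n           ∎
      where
      term = binomialTerm x y (suc n)

      first : term Fin.zero ≡ y ^ suc n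
      first = trans (+-identityʳ _) (*-identityˡ _)

      middle : ∀ i → term (Fin.suc (inject₁ i)) ≡ 0#
      middle i = p∣n⇒n·x≡0 (prime∣C p-prime (s≤s z≤n) (s≤s (subst (ℕ._< n) (sym (toℕ-inject₁ i)) (toℕ<n i)))) _

      last : term (Fin.suc (fromℕ n)) ≡ x ^ suc n
      last = begin
        (suc n C suc (toℕ (fromℕ n))) · (x ^ suc (toℕ (fromℕ n)) * y ^ (n ∸ toℕ (fromℕ n)))
          ≡⟨ cong (λ m → (suc n C suc m) · (x ^ suc m * y ^ (n ∸ m))) (toℕ-fromℕ n) ⟩
        (suc n C suc n) · (x ^ suc n * y ^ (n ∸ n))
          ≡⟨ cong₂ (λ c m → c · (x ^ suc n * y ^ m)) (nCn≡1 (suc n)) (ℕ.n∸n≡0 n) ⟩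
        1 · (x ^ suc n * 1#)  ≡⟨ trans (+-identityʳ _) (*-identityʳ _) ⟩
        x ^ suc n             ∎

  frobenius^ : ∀ n → AdditivePower (p ℕ.^ n)
  frobenius^ zero x y = trans (*-identityʳ _) (sym (cong₂ _+_ (*-identityʳ x) (*-identityʳ y)))
  frobenius^ (suc n) x y = begin
    (x + y) ^ (p ℕ.* p ℕ.^ n)                      ≡⟨ ^-assocʳ (x + y) p (p ℕ.^ n) ⟨
    ((x + y) ^ p) ^ (p ℕ.^ n)                      ≡⟨ cong (_^ (p ℕ.^ n)) (frobenius x y) ⟩
    (x ^ p + y ^ p) ^ (p ℕ.^ n)                    ≡⟨ frobenius^ n (x ^ p) (y ^ p) ⟩
    (x ^ p) ^ (p ℕ.^ n) + (y ^ p) ^ (p ℕ.^ n)      ≡⟨ cong₂ _+_ (^-assocʳ x p _) (^-assocʳ y p _) ⟩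
    x ^ (p ℕ.* p ℕ.^ n) + y ^ (p ℕ.* p ℕ.^ n)      ∎
    where open ≡-Reasoning

-- The subfield of order r fixed by x ↦ x^r.

module CubicExtension {q} (F : FiniteField q) {r} (1<r : 1 ℕ.< r) (q≡r³ : q ≡ r ℕ.* (r ℕ.* r))
  (^r-+ : FieldProperties.AdditivePower F r) where

  open FiniteField F using (Carrier; _≟_)
  open FieldProperties F
  open ≡-Reasoning

  private
    -- Makes room for the two lowest coefficients when polynomials with a term X^r are spelled out
    -- as lists.
    r-2 : ℕ
    r-2 = r ∸ 2

    r≡2+ : r ≡ 2 ℕ.+ r-2
    r≡2+ = sym (ℕ.m+[n∸m]≡n 1<r)

    instance
      r≢0 : ℕ.NonZero r
      r≢0 = ℕ.>-nonZero (ℕ.<-trans (s≤s z≤n) 1<r)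

  0^r≡0 : 0# ^ r ≡ 0#
  0^r≡0 = trans (cong (0# ^_) r≡2+) (zeroˡ _)

  ^r-neg : ∀ x → (- x) ^ r ≡ - (x ^ r)
  ^r-neg x = neg-uniqueʳ (x ^ r) _ (trans (sym (^r-+ x (- x))) (trans (cong (_^ r) (-‿inverseʳ x)) 0^r≡0))

  Fixed : Carrier → Set
  Fixed x = x ^ r ≡ x

  Fixed? : ∀ x → Dec (Fixed x)
  Fixed? x = (x ^ r) ≟ x

  Fixed-1 : Fixed 1#
  Fixed-1 = 1^n≡1 r

  Fixed-+ : ∀ {x y} → Fixed x → Fixed y → Fixed (x + y)
  Fixed-+ {x} {y} fx fy = trans (^r-+ x y) (cong₂ _+_ fx fy)

  Fixed-neg : ∀ {x} → Fixed x → Fixed (- x)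
  Fixed-neg {x} fx = trans (^r-neg x) (cong -_ fx)

  Fixed-* : ∀ {x y} → Fixed x → Fixed y → Fixed (x * y)
  Fixed-* {x} {y} fx fy = trans (^-distrib-* x y r) (cong₂ _*_ fx fy)

  Fixed-⁻¹ : ∀ {x} (x≢0 : x ≢ 0#) → Fixed x → Fixed (x ⁻¹⟨ x≢0 ⟩)
  Fixed-⁻¹ {x} x≢0 fx = *-cancelˡ x≢0 (begin
    x * y ^ r      ≡⟨ cong (_* y ^ r) fx ⟨
    x ^ r * y ^ r  ≡⟨ ^-distrib-* x y r ⟨
    (x * y) ^ r    ≡⟨ cong (_^ r) (*-inverse x x≢0) ⟩
    1# ^ r         ≡⟨ 1^n≡1 r ⟩
    1#             ≡⟨ *-inverse x x≢0 ⟨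
    x * y          ∎)
    where y = x ⁻¹⟨ x≢0 ⟩

  subfield : List Carrier
  subfield = filter Fixed? elements

  subfield-Unique : Unique subfield
  subfield-Unique = Unique.filter⁺ Fixed? elements-Unique

  ∈-subfield⁺ : ∀ {x} → Fixed x → x ∈ subfield
  ∈-subfield⁺ = ∈-filter⁺ Fixed? (∈-elements _)

  ∈-subfield⁻ : ∀ {x} → x ∈ subfield → Fixed x
  ∈-subfield⁻ x∈ = proj₂ (∈-filter⁻ Fixed? {xs = elements} x∈)

  -- The coefficient list is that of X^r - X.
  length-subfield≤r : length subfield ℕ.≤ r
  length-subfield≤r = subst (length subfield ℕ.≤_) degree
    (length-roots≤degree (0# ∷ - 1# ∷ replicate r-2 0#) subfield subfield-Unique (All.tabulate (root ∘ ∈-subfield⁻)))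
    where
    degree : 2 ℕ.+ length (replicate r-2 0#) ≡ r
    degree = trans (cong (2 ℕ.+_) (length-replicate r-2)) (sym r≡2+)

    root : ∀ {x} → Fixed x → monic (0# ∷ - 1# ∷ replicate r-2 0#) x ≡ 0#
    root {x} fx = begin
      0# + x * (- 1# + x * monic (replicate r-2 0#) x)  ≡⟨ +-identityˡ _ ⟩
      x * (- 1# + x * monic (replicate r-2 0#) x)       ≡⟨ cong (λ z → x * (- 1# + x * z)) (monic-0s r-2 x) ⟩
      x * (- 1# + x ^ suc r-2)       ≡⟨ distribˡ x (- 1#) _ ⟩
      x * - 1# + x ^ (2 ℕ.+ r-2)     ≡⟨ cong₂ _+_ (sym (-‿distribʳ-* x 1#)) (trans (cong (x ^_) (sym r≡2+)) fx) ⟩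
      - (x * 1#) + x                 ≡⟨ cong (λ z → - z + x) (*-identityʳ x) ⟩
      - x + x                        ≡⟨ -‿inverseˡ x ⟩
      0#                             ∎

  -- The trace, and the lower bound for the order of the subfield.

  -- Since q = r³, this is the trace of the field over its subfield of order r.
  trace : Carrier → Carrier
  trace x = x + (x ^ r + (x ^ r) ^ r)

  traceZeros : List Carrier
  traceZeros = filter (λ x → trace x ≟ 0#) elements

  length-traceZeros≤r² : length traceZeros ℕ.≤ r ℕ.* r
  length-traceZeros≤r² = subst (length traceZeros ℕ.≤_) degree
    (length-roots≤degree coeffs traceZeros (Unique.filter⁺ _ elements-Unique)
      (All.tabulate λ x∈ → trans (monic≡trace _) (proj₂ (∈-filter⁻ (λ x → trace x ≟ 0#) {xs = elements} x∈))))
    where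
    -- The number of zero coefficients strictly between X^r and X^(r²). The subtraction is exact
    -- because r + 1 ≤ 2r ≤ r².
    e : ℕ
    e = r ℕ.* r ∸ suc r

    r²≡ : r ℕ.* r ≡ suc r ℕ.+ e
    r²≡ = sym (ℕ.m+[n∸m]≡n (ℕ.≤-trans (ℕ.+-monoˡ-≤ r (ℕ.<⇒≤ 1<r))
      (ℕ.≤-trans (ℕ.≤-reflexive (cong (r ℕ.+_) (sym (ℕ.+-identityʳ r)))) (ℕ.*-monoˡ-≤ r 1<r))))

    coeffs : List Carrier
    coeffs = 0# ∷ 1# ∷ replicate r-2 0# ++ 1# ∷ replicate e 0#

    degree : length coeffs ≡ r ℕ.* r
    degree = begin
      2 ℕ.+ length (replicate r-2 0# ++ 1# ∷ replicate e 0#)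
        ≡⟨ cong (2 ℕ.+_) (length-++ (replicate r-2 0#)) ⟩
      2 ℕ.+ (length (replicate r-2 0#) ℕ.+ suc (length (replicate e 0#)))
        ≡⟨ cong₂ (λ m n → 2 ℕ.+ (m ℕ.+ suc n)) (length-replicate r-2) (length-replicate e) ⟩
      2 ℕ.+ r-2 ℕ.+ suc e  ≡⟨ cong (ℕ._+ suc e) r≡2+ ⟨
      r ℕ.+ suc e          ≡⟨ ℕ.+-suc r e ⟩
      suc r ℕ.+ e          ≡⟨ r²≡ ⟨
      r ℕ.* r              ∎

    monic≡trace : ∀ x → monic coeffs x ≡ trace x
    monic≡trace x = begin
      0# + x * (1# + x * monic (replicate r-2 0# ++ 1# ∷ replicate e 0#) x)
        ≡⟨ +-identityˡ _ ⟩
      x * (1# + x * monic (replicate r-2 0# ++ 1# ∷ replicate e 0#) x)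
        ≡⟨ cong (λ z → x * (1# + x * z)) (monic-0s++ r-2 (1# ∷ replicate e 0#) x) ⟩
      x * (1# + x * (x ^ r-2 * (1# + x * monic (replicate e 0#) x)))
        ≡⟨ cong (λ z → x * (1# + x * (x ^ r-2 * (1# + x * z)))) (monic-0s e x) ⟩
      x * (1# + x * (x ^ r-2 * (1# + x ^ suc e)))
        ≡⟨ solve 4 (λ x o a b → x :* (o :+ x :* (a :* (o :+ b))) := x :* o :+ ((x :* (x :* a)) :* o :+ (x :* (x :* a)) :* b)) refl x 1# (x ^ r-2) (x ^ suc e) ⟩
      x * 1# + (x ^ (2 ℕ.+ r-2) * 1# + x ^ (2 ℕ.+ r-2) * x ^ suc e)
        ≡⟨ cong₂ _+_ (*-identityʳ x) (cong₂ _+_ (*-identityʳ _) (sym (^-homo-* x (2 ℕ.+ r-2) (suc e)))) ⟩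
      x + (x ^ (2 ℕ.+ r-2) + x ^ (2 ℕ.+ r-2 ℕ.+ suc e))
        ≡⟨ cong (λ n → x + (x ^ n + x ^ (n ℕ.+ suc e))) (sym r≡2+) ⟩
      x + (x ^ r + x ^ (r ℕ.+ suc e))
        ≡⟨ cong (λ n → x + (x ^ r + x ^ n)) (trans (ℕ.+-suc r e) (sym r²≡)) ⟩
      x + (x ^ r + x ^ (r ℕ.* r))
        ≡⟨ cong (λ z → x + (x ^ r + z)) (sym (^-assocʳ x r r)) ⟩
      x + (x ^ r + (x ^ r) ^ r) ∎

  difference : Carrier → Carrier
  difference x = x ^ r - x

  -- With φ(x) = x^r the sum (φx - x) + (φ²x - φx) + (φ³x - φ²x) telescopes, and φ³x = x^q = x.
  trace-difference : ∀ x → trace (difference x) ≡ 0#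
  trace-difference x = begin
    (a - x) + ((a - x) ^ r + ((a - x) ^ r) ^ r)
      ≡⟨ cong (λ z → (a - x) + (z + z ^ r)) (^r-- a x) ⟩
    (a - x) + ((b - a) + (b - a) ^ r)
      ≡⟨ cong (λ z → (a - x) + ((b - a) + z)) (trans (^r-- b a) (cong (_- b) b^r≡x)) ⟩
    (a - x) + ((b - a) + (x - b))
      ≡⟨ solve 6 (λ a a′ b b′ x x′ → (a :+ x′) :+ ((b :+ a′) :+ (x :+ b′)) := (a :+ a′) :+ ((b :+ b′) :+ (x :+ x′))) refl a (- a) b (- b) x (- x) ⟩
    (a - a) + ((b - b) + (x - x))
      ≡⟨ cong₂ _+_ (-‿inverseʳ a) (cong₂ _+_ (-‿inverseʳ b) (-‿inverseʳ x)) ⟩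
    0# + (0# + 0#)
      ≡⟨ trans (+-identityˡ _) (+-identityˡ 0#) ⟩
    0# ∎
    where
    a = x ^ r
    b = a ^ r

    ^r-- : ∀ y z → (y - z) ^ r ≡ y ^ r - z ^ r
    ^r-- y z = trans (^r-+ y (- z)) (cong (y ^ r +_) (^r-neg z))

    b^r≡x : b ^ r ≡ x
    b^r≡x = begin
      ((x ^ r) ^ r) ^ r          ≡⟨ ^-assocʳ (x ^ r) r r ⟩
      (x ^ r) ^ (r ℕ.* r)        ≡⟨ ^-assocʳ x r (r ℕ.* r) ⟩
      x ^ (r ℕ.* (r ℕ.* r))      ≡⟨ cong (x ^_) (sym q≡r³) ⟩
      x ^ q                      ≡⟨ x^q≡x x ⟩
      x                          ∎

  difference≡⇒Fixed : ∀ x y → difference x ≡ difference y → Fixed (x - y)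
  difference≡⇒Fixed x y eq = begin
    (x - y) ^ r          ≡⟨ ^r-+ x (- y) ⟩
    x ^ r + (- y) ^ r    ≡⟨ cong (x ^ r +_) (^r-neg y) ⟩
    x ^ r - y ^ r        ≡⟨ cong (_- y ^ r) ([x-y]+y≡x x (x ^ r)) ⟨
    ((x ^ r - x) + x) - y ^ r   ≡⟨ cong (λ z → (z + x) - y ^ r) eq ⟩
    ((y ^ r - y) + x) - y ^ r
      ≡⟨ solve 4 (λ b y′ x b′ → ((b :+ y′) :+ x) :+ b′ := (x :+ y′) :+ (b :+ b′)) refl (y ^ r) (- y) x (- (y ^ r)) ⟩
    (x - y) + (y ^ r - y ^ r)   ≡⟨ cong ((x - y) +_) (-‿inverseʳ _) ⟩
    (x - y) + 0#                ≡⟨ +-identityʳ _ ⟩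
    x - y                       ∎

  -- The kernel of difference is the subfield and its image lies in traceZeros, so r³ ≤ |subfield| r².
  r≤length-subfield : r ℕ.≤ length subfield
  r≤length-subfield = ℕ.*-cancelʳ-≤ r (length subfield) (r ℕ.* r) {{ℕ.m*n≢0 r r}}
    (ℕ.≤-trans (subst₂ ℕ._≤_ (trans length-elements q≡r³) (length-cartesianProductWith _ subfield traceZeros)
      (Unique-⊆⇒length-≤ elements-Unique covered))
      (ℕ.*-monoʳ-≤ (length subfield) length-traceZeros≤r²))
    where
    -- A section of `difference`, found by search; the default `0#` occurs only off the image.
    preimage : Carrier → Carrier
    preimage y with Any.any? (λ x → difference x ≟ y) elements
    ... | yes any = proj₁ (find any)
    ... | no _ = 0#

    difference-preimage : ∀ x → difference (preimage (difference x)) ≡ difference x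
    difference-preimage x with Any.any? (λ z → difference z ≟ difference x) elements
    ... | yes any = proj₂ (proj₂ (find any))
    ... | no ¬any = contradiction (Any.map (λ where refl → refl) (∈-elements x)) ¬any

    -- Each x differs from the chosen point of its fibre by an element of the kernel.
    covered : elements ⊆ cartesianProductWith (λ z y → z + preimage y) subfield traceZeros
    covered {x} _ = subst (_∈ cartesianProductWith _ subfield traceZeros) ([x-y]+y≡x (preimage (difference x)) x)
      (∈-cartesianProductWith⁺ _ (∈-subfield⁺ (difference≡⇒Fixed x _ (sym (difference-preimage x))))
        (∈-filter⁺ _ (∈-elements _) (trace-difference x)))

  length-subfield : length subfield ≡ r
  length-subfield = ℕ.≤-antisym length-subfield≤r r≤length-subfield

  r<q : r ℕ.< q
  r<q = subst₂ ℕ._<_ (ℕ.*-identityʳ r) (sym q≡r³) (ℕ.*-monoʳ-< r (ℕ.*-mono-< 1<r 1<r))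

  -- The plane spanned by 1 and α over the subfield.

  ∃-¬Fixed : ∃ λ α → ¬ Fixed α
  ∃-¬Fixed with All.all? Fixed? elements
  ... | yes all = contradiction
        (subst₂ ℕ._≤_ length-elements length-subfield (Unique-⊆⇒length-≤ elements-Unique (∈-subfield⁺ ∘ All.lookup all)))
        (ℕ.<⇒≱ r<q)
  ... | no ¬all with α , _ , ¬fixed ← find (¬All⇒Any¬ Fixed? elements ¬all) = α , ¬fixed

  α : Carrier
  α = proj₁ ∃-¬Fixed

  plane : List Carrier
  plane = map (λ (s , t) → s + t * α) (cartesianProduct subfield subfield)

  length-plane : length plane ≡ r ℕ.* r
  length-plane = trans (length-map _ (cartesianProduct subfield subfield))
    (trans (length-cartesianProductWith _,_ subfield subfield) (cong₂ ℕ._*_ length-subfield length-subfield))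

  InPlane : Carrier → Set
  InPlane x = ∃₂ λ s t → Fixed s × Fixed t × x ≡ s + t * α

  ∈-plane⁻ : ∀ {x} → x ∈ plane → InPlane x
  ∈-plane⁻ x∈ with (s , t) , st∈ , eq ← ∈-map⁻ _ x∈ with s∈ , t∈ ← ∈-cartesianProduct⁻ subfield subfield st∈ =
    s , t , ∈-subfield⁻ s∈ , ∈-subfield⁻ t∈ , eq

  InPlane-+ : ∀ {x y} → InPlane x → InPlane y → InPlane (x + y)
  InPlane-+ (s , t , fs , ft , refl) (s′ , t′ , fs′ , ft′ , refl) =
    s + s′ , t + t′ , Fixed-+ fs fs′ , Fixed-+ ft ft′ ,
    solve 5 (λ s t s′ t′ a → (s :+ t :* a) :+ (s′ :+ t′ :* a) := (s :+ s′) :+ (t :+ t′) :* a) refl s t s′ t′ α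

  InPlane-* : ∀ {c x} → Fixed c → InPlane x → InPlane (c * x)
  InPlane-* {c} fc (s , t , fs , ft , refl) =
    c * s , c * t , Fixed-* fc fs , Fixed-* fc ft ,
    solve 4 (λ c s t a → c :* (s :+ t :* a) := c :* s :+ (c :* t) :* a) refl c s t α

  InPlane-neg : ∀ {x} → InPlane x → InPlane (- x)
  InPlane-neg {x} x∈ = subst InPlane (trans (sym (-‿distribˡ-* 1# x)) (cong -_ (*-identityˡ x)))
    (InPlane-* (Fixed-neg Fixed-1) x∈)

  -- If t ≠ t′, then α = (s′ - s)/(t - t′) would lie in the subfield.
  coordinates-injective : ∀ {s s′ t t′} → Fixed s → Fixed s′ → Fixed t → Fixed t′ →
                          s + t * α ≡ s′ + t′ * α → s ≡ s′ × t ≡ t′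
  coordinates-injective {s} {s′} {t} {t′} fs fs′ ft ft′ eq with t ≟ t′
  ... | yes refl = +-cancelʳ (t * α) s s′ eq , refl
  ... | no t≢t′ = contradiction
        (subst Fixed (sym α≡) (Fixed-* (Fixed-⁻¹ t-t′≢0 (Fixed-+ ft (Fixed-neg ft′))) (Fixed-+ fs′ (Fixed-neg fs))))
        (proj₂ ∃-¬Fixed)
    where
    t-t′≢0 : t - t′ ≢ 0#
    t-t′≢0 = t≢t′ ∘ x-y≡0⇒x≡y t t′

    [t-t′]α≡ : (t - t′) * α ≡ s′ - s
    [t-t′]α≡ = begin
      (t - t′) * α                        ≡⟨ +-identityˡ _ ⟨
      0# + (t - t′) * α                   ≡⟨ cong (_+ (t - t′) * α) (-‿inverseʳ s) ⟨
      (s - s) + (t - t′) * α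
        ≡⟨ solve 5 (λ s n t m a → (s :+ n) :+ (t :+ m) :* a := (s :+ t :* a) :+ (n :+ m :* a)) refl s (- s) t (- t′) α ⟩
      (s + t * α) + (- s + - t′ * α)      ≡⟨ cong (_+ (- s + - t′ * α)) eq ⟩
      (s′ + t′ * α) + (- s + - t′ * α)
        ≡⟨ solve 5 (λ s n t m a → (s :+ t :* a) :+ (n :+ m :* a) := (s :+ n) :+ (t :+ m) :* a) refl s′ (- s) t′ (- t′) α ⟩
      (s′ - s) + (t′ - t′) * α            ≡⟨ cong (λ z → (s′ - s) + z * α) (-‿inverseʳ t′) ⟩
      (s′ - s) + 0# * α                   ≡⟨ cong ((s′ - s) +_) (zeroˡ α) ⟩
      (s′ - s) + 0#                       ≡⟨ +-identityʳ _ ⟩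
      s′ - s                              ∎

    α≡ : α ≡ ((t - t′) ⁻¹⟨ t-t′≢0 ⟩) * (s′ - s)
    α≡ = *-cancelˡ t-t′≢0 (trans [t-t′]α≡ (sym (trans (sym (*-assoc _ _ _))
      (trans (cong (_* (s′ - s)) (*-inverse (t - t′) t-t′≢0)) (*-identityˡ _)))))

  plane-Unique : Unique plane
  plane-Unique = Unique-map _ (Unique.cartesianProduct⁺ subfield-Unique subfield-Unique) inj
    where
    inj : ∀ {(s , t) (s′ , t′) : Carrier × Carrier} →
          (s , t) ∈ cartesianProduct subfield subfield → (s′ , t′) ∈ cartesianProduct subfield subfield →
          s + t * α ≡ s′ + t′ * α → (s , t) ≡ (s′ , t′)
    inj st∈ st∈′ eq
      with s∈ , t∈ ← ∈-cartesianProduct⁻ subfield subfield st∈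
         | s∈′ , t∈′ ← ∈-cartesianProduct⁻ subfield subfield st∈′
      with refl , refl ← coordinates-injective (∈-subfield⁻ s∈) (∈-subfield⁻ s∈′) (∈-subfield⁻ t∈) (∈-subfield⁻ t∈′) eq = refl

  -- Representatives of the lines of the plane: every element is a subfield multiple of one of these.
  projectiveLine : List Carrier
  projectiveLine = 1# ∷ map (_+ α) subfield

  length-projectiveLine : length projectiveLine ≡ suc r
  length-projectiveLine = cong suc (trans (length-map _ subfield) length-subfield)

  -- Divide by the coefficient of α. When it vanishes the representative `1#` serves, also for the
  -- zero vector.
  InPlane⇒multiple : ∀ {x} → InPlane x → ∃₂ λ c y → Fixed c × y ∈ projectiveLine × x ≡ c * y
  InPlane⇒multiple (s , t , fs , ft , refl) with t ≟ 0#
  ... | yes refl = s , 1# , fs , here refl ,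
        trans (cong (s +_) (zeroˡ α)) (trans (+-identityʳ s) (sym (*-identityʳ s)))
  ... | no t≢0 = t , t⁻¹ * s + α , ft , there (∈-map⁺ _ (∈-subfield⁺ (Fixed-* (Fixed-⁻¹ t≢0 ft) fs))) , (begin
        s + t * α                 ≡⟨ cong (_+ t * α) (*-identityˡ s) ⟨
        1# * s + t * α            ≡⟨ cong (λ z → z * s + t * α) (*-inverse t t≢0) ⟨
        (t * t⁻¹) * s + t * α     ≡⟨ solve 4 (λ t u s a → (t :* u) :* s :+ t :* a := t :* (u :* s :+ a)) refl t t⁻¹ s α ⟩
        t * (t⁻¹ * s + α)         ∎)
    where t⁻¹ = t ⁻¹⟨ t≢0 ⟩

  -- Products of two elements of the plane.

  scaledProduct : Carrier → Carrier × Carrier → Carrier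
  scaledProduct c (x , y) = c * (x * y)

  -- Repetitions are harmless: the list serves only as an upper bound.
  products : List Carrier
  products = cartesianProductWith scaledProduct subfield (unorderedPairs projectiveLine)

  length-products : 2 ℕ.* length products ≡ r ℕ.* (suc r ℕ.* suc (suc r))
  length-products = begin
    2 ℕ.* length products                     ≡⟨ cong (2 ℕ.*_) (length-cartesianProductWith scaledProduct subfield pairs) ⟩
    2 ℕ.* (length subfield ℕ.* length pairs)  ≡⟨ cong (λ n → 2 ℕ.* (n ℕ.* length pairs)) length-subfield ⟩
    2 ℕ.* (r ℕ.* length pairs)                ≡⟨ ℕ.*-comm 2 (r ℕ.* length pairs) ⟩
    (r ℕ.* length pairs) ℕ.* 2                ≡⟨ ℕ.*-assoc r _ 2 ⟩
    r ℕ.* (length pairs ℕ.* 2)                ≡⟨ cong (r ℕ.*_) (ℕ.*-comm (length pairs) 2) ⟩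
    r ℕ.* (2 ℕ.* length pairs)                ≡⟨ cong (r ℕ.*_) (length-unorderedPairs projectiveLine) ⟩
    r ℕ.* (length projectiveLine ℕ.* suc (length projectiveLine))
      ≡⟨ cong (λ n → r ℕ.* (n ℕ.* suc n)) length-projectiveLine ⟩
    r ℕ.* (suc r ℕ.* suc (suc r))             ∎
    where pairs = unorderedPairs projectiveLine

  -- The two scalars merge, (cu)(dv) = (cd)(uv), and u, v may be swapped to match the listed order
  -- of the pair.
  InPlane-*⇒∈-products : ∀ {x y} → InPlane x → InPlane y → (x * y) ∈ products
  InPlane-*⇒∈-products x∈ y∈
    with c , u , fc , u∈ , refl ← InPlane⇒multiple x∈ | d , v , fd , v∈ , refl ← InPlane⇒multiple y∈
    with ∈-unorderedPairs u∈ v∈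
  ... | inj₁ uv∈ = subst (_∈ products)
        (solve 4 (λ c u d v → (c :* d) :* (u :* v) := (c :* u) :* (d :* v)) refl c u d v)
        (∈-cartesianProductWith⁺ scaledProduct (∈-subfield⁺ (Fixed-* fc fd)) uv∈)
  ... | inj₂ vu∈ = subst (_∈ products)
        (solve 4 (λ c u d v → (c :* d) :* (v :* u) := (c :* u) :* (d :* v)) refl c u d v)
        (∈-cartesianProductWith⁺ scaledProduct (∈-subfield⁺ (Fixed-* fc fd)) vu∈)

  -- The point set and its distances.

  square : List (Carrier × Carrier)
  square = cartesianProduct plane plane

  square-Unique : Unique square
  square-Unique = Unique.cartesianProduct⁺ plane-Unique plane-Unique

  length-square : length square ≡ (r ℕ.* r) ℕ.* (r ℕ.* r)
  length-square = trans (length-cartesianProductWith _,_ plane plane) (cong₂ ℕ._*_ length-plane length-plane)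

  module _ {i} (fixed-i : Fixed i) (i²≡-1 : i * i ≡ - 1#) where
    open FiniteField F using (Δ; ∣Δ∣; dist; dot)

    dot-factors : ∀ x y → dot (x , y) ≡ (x + i * y) * (x + - i * y)
    dot-factors x y = sym (begin
      (x + i * y) * (x + - i * y)
        ≡⟨ solve 4 (λ x y i j → (x :+ i :* y) :* (x :+ j :* y) := (x :* x :+ (i :* j) :* (y :* y)) :+ (i :+ j) :* (x :* y)) refl x y i (- i) ⟩
      (x * x + (i * - i) * (y * y)) + (i - i) * (x * y)
        ≡⟨ cong₂ (λ u v → (x * x + u * (y * y)) + v * (x * y)) i*-i≡1 (-‿inverseʳ i) ⟩
      (x * x + 1# * (y * y)) + 0# * (x * y)
        ≡⟨ cong₂ _+_ (cong (x * x +_) (*-identityˡ _)) (zeroˡ _) ⟩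
      (x * x + y * y) + 0#
        ≡⟨ +-identityʳ _ ⟩
      x * x + y * y ∎)
      where
      i*-i≡1 : i * - i ≡ 1#
      i*-i≡1 = trans (sym (-‿distribʳ-* i i)) (trans (cong -_ i²≡-1) (-‿involutive 1#))

    -- The coordinate differences z₁, z₂ stay in the plane, and so do z₁ + i z₂ and z₁ - i z₂
    -- because i is a scalar of the subfield.
    Δ-square⊆products : Δ square ⊆ products
    Δ-square⊆products {d} d∈
      with ((x₁ , x₂) , (y₁ , y₂) , x∈ , y∈ , refl) ← ∈-cartesianProductWith⁻ dist square square (∈-deduplicate⁻ _≟_ _ d∈)
      with x₁∈ , x₂∈ ← ∈-cartesianProduct⁻ plane plane x∈ | y₁∈ , y₂∈ ← ∈-cartesianProduct⁻ plane plane y∈ =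
      subst (_∈ products) (sym (dot-factors (x₁ - y₁) (x₂ - y₂)))
        (InPlane-*⇒∈-products (InPlane-+ z₁∈ (InPlane-* fixed-i z₂∈)) (InPlane-+ z₁∈ (InPlane-* (Fixed-neg fixed-i) z₂∈)))
      where
      z₁∈ : InPlane (x₁ - y₁)
      z₁∈ = InPlane-+ (∈-plane⁻ x₁∈) (InPlane-neg (∈-plane⁻ y₁∈))
      z₂∈ : InPlane (x₂ - y₂)
      z₂∈ = InPlane-+ (∈-plane⁻ x₂∈) (InPlane-neg (∈-plane⁻ y₂∈))

    ∣Δ-square∣-bound : 2 ℕ.* ∣Δ∣ square ℕ.≤ r ℕ.* (suc r ℕ.* suc (suc r))
    ∣Δ-square∣-bound = subst (2 ℕ.* ∣Δ∣ square ℕ.≤_) length-products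
      (ℕ.*-monoʳ-≤ 2 (Unique-⊆⇒length-≤ (deduplicate-! _≟_ _) Δ-square⊆products))

-- Arithmetic of natural numbers.

odd-^ : ∀ {p j} → p ≡ suc (2 ℕ.* j) → ∀ n → ∃ λ l → p ℕ.^ n ≡ suc (2 ℕ.* l)
odd-^ _ zero = 0 , refl
odd-^ {p} {j} p≡ (suc n) with l , p^n≡ ← odd-^ {p} {j} p≡ n =
  j ℕ.+ l ℕ.+ 2 ℕ.* (j ℕ.* l) , trans (cong₂ ℕ._*_ p≡ p^n≡) (identity j l)
  where
  identity : ∀ j l → suc (2 ℕ.* j) ℕ.* suc (2 ℕ.* l) ≡ suc (2 ℕ.* (j ℕ.+ l ℕ.+ 2 ℕ.* (j ℕ.* l)))
  identity = ℕ-Solver.solve-∀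

prime-2-or-odd : ∀ {p} → Prime p → p ≡ 2 ⊎ ∃ λ j → p ≡ suc (2 ℕ.* j)
prime-2-or-odd {p} p-prime with p ℕ.% 2 | m%n<n p 2 | m≡m%n+[m/n]*n p 2
... | 1 | _ | p≡ = inj₂ (p ℕ./ 2 , trans p≡ (cong suc (ℕ.*-comm (p ℕ./ 2) 2)))
... | suc (suc _) | s≤s (s≤s ()) | _
... | 0 | _ | p≡ with prime⇒irreducible p-prime (divides (p ℕ./ 2) p≡)
...   | inj₂ 2≡p = inj₁ (sym 2≡p)

-- Turns a lower bound on q = r³ into one on r.
cube-cancel-≤ : ∀ m n → m ℕ.* (m ℕ.* m) ℕ.≤ n ℕ.* (n ℕ.* n) → m ℕ.≤ n
cube-cancel-≤ m n m³≤n³ with m ℕ.≤? n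
... | yes m≤n = m≤n
... | no m≰n = contradiction m³≤n³ (ℕ.<⇒≱ (ℕ.*-mono-< n<m (ℕ.*-mono-< n<m n<m)))
  where n<m = ℕ.≰⇒> m≰n

-- The gap r² - 3r - 2 equals 2 + 5e + e² at r = 4 + e, and is negative at r = 3.
4≤r⇒[1+r][2+r]<2r² : ∀ {r} → 4 ℕ.≤ r → suc r ℕ.* suc (suc r) ℕ.< 2 ℕ.* (r ℕ.* r)
4≤r⇒[1+r][2+r]<2r² {r} 4≤r with e , refl ← ℕ.m≤n⇒∃[o]m+o≡n 4≤r =
  subst (suc (suc r ℕ.* suc (suc r)) ℕ.≤_) (identity e) (ℕ.m≤m+n _ _)
  where
  identity : ∀ e → suc (suc (4 ℕ.+ e) ℕ.* suc (suc (4 ℕ.+ e))) ℕ.+ (1 ℕ.+ 5 ℕ.* e ℕ.+ e ℕ.* e) ≡ 2 ℕ.* ((4 ℕ.+ e) ℕ.* (4 ℕ.+ e))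
  identity = ℕ-Solver.solve-∀

-- A quantitative form of (1 + 1/r)(1 + 2/r) → 1. The summand added in `identity` is the gap 2r² -
-- 3(k+1)r - 2(k+1), expanded at r = 3(k+1) + e.
3[k+1]≤r⇒[k+1][1+r][2+r]≤[k+3]r² : ∀ k {r} → 3 ℕ.* (k ℕ.+ 1) ℕ.≤ r →
                                   (k ℕ.+ 1) ℕ.* (suc r ℕ.* suc (suc r)) ℕ.≤ (k ℕ.+ 3) ℕ.* (r ℕ.* r)
3[k+1]≤r⇒[k+1][1+r][2+r]≤[k+3]r² k {r} 3[k+1]≤r with e , refl ← ℕ.m≤n⇒∃[o]m+o≡n 3[k+1]≤r =
  subst ((k ℕ.+ 1) ℕ.* (suc r ℕ.* suc (suc r)) ℕ.≤_) (identity k e) (ℕ.m≤m+n _ _)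
  where
  identity : ∀ k e → let r = 3 ℕ.* (k ℕ.+ 1) ℕ.+ e in
    (k ℕ.+ 1) ℕ.* (suc r ℕ.* suc (suc r)) ℕ.+ ((k ℕ.+ 1) ℕ.* (9 ℕ.* k ℕ.+ 7) ℕ.+ 9 ℕ.* ((k ℕ.+ 1) ℕ.* e) ℕ.+ 2 ℕ.* (e ℕ.* e))
      ≡ (k ℕ.+ 3) ℕ.* (r ℕ.* r)
  identity = ℕ-Solver.solve-∀

n<p^n : ∀ {p} → 1 ℕ.< p → ∀ n → n ℕ.< p ℕ.^ n
n<p^n 1<p zero = s≤s z≤n
n<p^n {p} 1<p (suc n) = begin-strict
  suc n                    ≤⟨ n<p^n 1<p n ⟩
  p ℕ.^ n                  <⟨ ℕ.m<m+n (p ℕ.^ n) (ℕ.≤-trans (s≤s z≤n) (n<p^n 1<p n)) ⟩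
  p ℕ.^ n ℕ.+ p ℕ.^ n      ≡⟨ cong (p ℕ.^ n ℕ.+_) (ℕ.+-identityʳ _) ⟨
  2 ℕ.* p ℕ.^ n            ≤⟨ ℕ.*-monoˡ-≤ (p ℕ.^ n) 1<p ⟩
  p ℕ.* p ℕ.^ n            ∎
  where open ℕ.≤-Reasoning

-- The choice of q and the resulting estimates.

module Construction {p} (p-prime : Prime p) where

  1<p : 1 ℕ.< p
  1<p = ℕ.nonTrivial⇒n>1 p {{prime⇒nonTrivial p-prime}}

  -- The even exponent makes r ≡ 1 mod 4 for odd p, so that -1 is a square in the subfield of order r.
  rootOrder : ℕ → ℕ
  rootOrder m = p ℕ.^ suc m ℕ.* p ℕ.^ suc m

  1+m<rootOrder : ∀ m → suc m ℕ.< rootOrder m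
  1+m<rootOrder m = ℕ.<-≤-trans (n<p^n 1<p (suc m)) (ℕ.m≤m*n (p ℕ.^ suc m) (p ℕ.^ suc m)
    {{ℕ.>-nonZero (ℕ.≤-trans (s≤s z≤n) (n<p^n 1<p (suc m)))}})

  -- Here the exponent `suc m` matters: r ≥ p² ≥ 4, as `Δ≢everything` requires.
  4≤rootOrder : ∀ m → 4 ℕ.≤ rootOrder m
  4≤rootOrder m = ℕ.*-mono-≤ 2≤ 2≤
    where
    2≤ : 2 ℕ.≤ p ℕ.^ suc m
    2≤ = ℕ.≤-trans (s≤s (s≤s z≤n)) (n<p^n 1<p (suc m))

  rootOrder≡p^ : ∀ m → rootOrder m ≡ p ℕ.^ (suc m ℕ.+ suc m)
  rootOrder≡p^ m = sym (ℕ.^-distribˡ-+-* p (suc m) (suc m))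

  rootOrder³≡p^ : ∀ m → let 2n = suc m ℕ.+ suc m in
                  rootOrder m ℕ.* (rootOrder m ℕ.* rootOrder m) ≡ p ℕ.^ (2n ℕ.+ (2n ℕ.+ 2n))
  rootOrder³≡p^ m = begin
    rootOrder m ℕ.* (rootOrder m ℕ.* rootOrder m)  ≡⟨ cong (λ n → n ℕ.* (n ℕ.* n)) (rootOrder≡p^ m) ⟩
    p ℕ.^ 2n ℕ.* (p ℕ.^ 2n ℕ.* p ℕ.^ 2n)           ≡⟨ cong (p ℕ.^ 2n ℕ.*_) (ℕ.^-distribˡ-+-* p 2n 2n) ⟨
    p ℕ.^ 2n ℕ.* p ℕ.^ (2n ℕ.+ 2n)                 ≡⟨ ℕ.^-distribˡ-+-* p 2n (2n ℕ.+ 2n) ⟨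
    p ℕ.^ (2n ℕ.+ (2n ℕ.+ 2n))                     ∎
    where
    open ≡-Reasoning
    2n = suc m ℕ.+ suc m

  module _ {q} (F : FiniteField q) m (q≡ : q ≡ rootOrder m ℕ.* (rootOrder m ℕ.* rootOrder m)) where
    open FiniteField F using (Δ; ∣Δ∣)

    private
      r : ℕ
      r = rootOrder m

      2n : ℕ
      2n = suc m ℕ.+ suc m

    open Characteristic F p-prime {2n ℕ.+ (2n ℕ.+ 2n)} (trans q≡ (rootOrder³≡p^ m))

    1<r : 1 ℕ.< r
    1<r = ℕ.≤-trans (s≤s (s≤s z≤n)) (4≤rootOrder m)

    open CubicExtension F 1<r q≡ (subst AdditivePower (sym (rootOrder≡p^ m)) (frobenius^ 2n)) public

    -- For p = 2 one has -1 = 1. For odd p, q ≡ 1 mod 4 provides i in the large field; then i⁴ = 1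
    -- and r ≡ 1 mod 4 give i^r = i.
    √-1∈subfield : ∃ λ i → Fixed i × i * i ≡ - 1#
    √-1∈subfield with prime-2-or-odd p-prime
    ... | inj₁ refl = 1# , Fixed-1 , trans (*-identityˡ 1#)
          (neg-uniqueʳ 1# 1# (trans (cong (1# +_) (sym (+-identityʳ 1#))) p·1≡0))
    ... | inj₂ (j , p≡) with odd-^ {j = j} p≡ (suc m)
    ...   | l , p^≡ = case √-1 t q≡1+4[1+t] of λ where (i , i²≡-1) → i , fixed i i²≡-1 , i²≡-1
      where
      open ≡-Reasoning
      u : ℕ
      u = l ℕ.+ l ℕ.* l

      r≡1+4u : r ≡ suc (4 ℕ.* u)
      r≡1+4u = trans (cong₂ ℕ._*_ p^≡ p^≡) (identity l)
        where
        identity : ∀ l → suc (2 ℕ.* l) ℕ.* suc (2 ℕ.* l) ≡ suc (4 ℕ.* (l ℕ.+ l ℕ.* l))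
        identity = ℕ-Solver.solve-∀

      -- `√-1` wants q - 1 to be a positive multiple of 4, so u must be a successor; it is, because
      -- r > 1.
      v : ℕ
      v = ℕ.pred u

      u≡1+v : u ≡ suc v
      u≡1+v with u | r≡1+4u
      ... | zero | r≡1 = contradiction r≡1 (ℕ.>⇒≢ 1<r)
      ... | suc _ | _ = refl

      -- Read off from (1 + 4u)³ = 1 + 4(3u + 12u² + 16u³) at u = `suc v`; one u is split off so
      -- that its successor becomes that of `suc t`.
      t : ℕ
      t = v ℕ.+ (2 ℕ.* suc v ℕ.+ 12 ℕ.* (suc v ℕ.* suc v) ℕ.+ 16 ℕ.* (suc v ℕ.* (suc v ℕ.* suc v)))

      q≡1+4[1+t] : q ≡ suc (4 ℕ.* suc t)
      q≡1+4[1+t] = trans q≡ (trans (cong (λ n → n ℕ.* (n ℕ.* n)) (trans r≡1+4u (cong (suc ∘ (4 ℕ.*_)) u≡1+v))) (identity (suc v)))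
        where
        identity : ∀ u → suc (4 ℕ.* u) ℕ.* (suc (4 ℕ.* u) ℕ.* suc (4 ℕ.* u)) ≡
                         suc (4 ℕ.* (u ℕ.+ (2 ℕ.* u ℕ.+ 12 ℕ.* (u ℕ.* u) ℕ.+ 16 ℕ.* (u ℕ.* (u ℕ.* u)))))
        identity = ℕ-Solver.solve-∀

      fixed : ∀ i → i * i ≡ - 1# → Fixed i
      fixed i i²≡-1 = begin
        i ^ r               ≡⟨ cong (i ^_) r≡1+4u ⟩
        i * i ^ (4 ℕ.* u)   ≡⟨ cong (i *_) (^-assocʳ i 4 u) ⟨
        i * (i ^ 4) ^ u     ≡⟨ cong (λ z → i * z ^ u) i⁴≡1 ⟩
        i * 1# ^ u          ≡⟨ cong (i *_) (1^n≡1 u) ⟩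
        i * 1#              ≡⟨ *-identityʳ i ⟩
        i                   ∎
        where
        i⁴≡1 : i ^ 4 ≡ 1#
        i⁴≡1 = begin
          i * (i * (i * (i * 1#)))   ≡⟨ solve 2 (λ i o → i :* (i :* (i :* (i :* o))) := ((i :* i) :* (i :* i)) :* o) refl i 1# ⟩
          ((i * i) * (i * i)) * 1#   ≡⟨ *-identityʳ _ ⟩
          (i * i) * (i * i)          ≡⟨ cong₂ _*_ i²≡-1 i²≡-1 ⟩
          - 1# * - 1#                ≡⟨ -‿distribˡ-* 1# (- 1#) ⟨
          - (1# * - 1#)              ≡⟨ cong -_ (*-identityˡ (- 1#)) ⟩
          - - 1#                     ≡⟨ -‿involutive 1# ⟩
          1#                         ∎

    ∣Δ∣-bound : 2 ℕ.* ∣Δ∣ square ℕ.≤ r ℕ.* (suc r ℕ.* suc (suc r))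
    ∣Δ∣-bound with i , fixed-i , i²≡-1 ← √-1∈subfield = ∣Δ-square∣-bound fixed-i i²≡-1

    -- Both sides are r¹²; cubing replaces the fractional exponent 4/3.
    length-square³≡q⁴ : length square ℕ.^ 3 ≡ q ℕ.^ 4
    length-square³≡q⁴ = trans (cong (ℕ._^ 3) length-square) (trans (identity r) (cong (ℕ._^ 4) (sym q≡)))
      where
      identity : ∀ r → let a = (r ℕ.* r) ℕ.* (r ℕ.* r) ; b = r ℕ.* (r ℕ.* r) in
                 a ℕ.* (a ℕ.* (a ℕ.* 1)) ≡ b ℕ.* (b ℕ.* (b ℕ.* (b ℕ.* 1)))
      identity = ℕ-Solver.solve-∀

    -- Otherwise 2r³ ≤ r(r+1)(r+2), which is false for r ≥ 4.
    Δ≢everything : ¬ (∀ d → d ∈ Δ square)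
    Δ≢everything all = ℕ.<⇒≱ (4≤r⇒[1+r][2+r]<2r² (4≤rootOrder m)) (ℕ.*-cancelˡ-≤ r {{ℕ.>-nonZero (ℕ.<⇒≤ 1<r)}} (begin
      r ℕ.* (2 ℕ.* (r ℕ.* r))            ≡⟨ identity r ⟩
      2 ℕ.* (r ℕ.* (r ℕ.* r))            ≡⟨ cong (2 ℕ.*_) (trans length-elements q≡) ⟨
      2 ℕ.* length elements              ≤⟨ ℕ.*-monoʳ-≤ 2 (Unique-⊆⇒length-≤ elements-Unique (λ _ → all _)) ⟩
      2 ℕ.* ∣Δ∣ square                   ≤⟨ ∣Δ∣-bound ⟩
      r ℕ.* (suc r ℕ.* suc (suc r))      ∎))
      where
      open ℕ.≤-Reasoning
      identity : ∀ r → r ℕ.* (2 ℕ.* (r ℕ.* r)) ≡ 2 ℕ.* (r ℕ.* (r ℕ.* r))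
      identity = ℕ-Solver.solve-∀

    -- The bound on the ratio is (k+3)/(2(k+1)) = 1/2 + 1/(k+1), which tends to 1/2 as k grows.
    ∣Δ∣-asymptotic : ∀ k → 3 ℕ.* (k ℕ.+ 1) ℕ.≤ r → 2 ℕ.* (k ℕ.+ 1) ℕ.* ∣Δ∣ square ℕ.≤ (k ℕ.+ 3) ℕ.* q
    ∣Δ∣-asymptotic k 3[k+1]≤r = begin
      2 ℕ.* (k ℕ.+ 1) ℕ.* ∣Δ∣ square                   ≡⟨ identity₁ k (∣Δ∣ square) ⟩
      (k ℕ.+ 1) ℕ.* (2 ℕ.* ∣Δ∣ square)                 ≤⟨ ℕ.*-monoʳ-≤ (k ℕ.+ 1) ∣Δ∣-bound ⟩
      (k ℕ.+ 1) ℕ.* (r ℕ.* (suc r ℕ.* suc (suc r)))    ≡⟨ identity₂ (k ℕ.+ 1) r (suc r ℕ.* suc (suc r)) ⟩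
      r ℕ.* ((k ℕ.+ 1) ℕ.* (suc r ℕ.* suc (suc r)))    ≤⟨ ℕ.*-monoʳ-≤ r (3[k+1]≤r⇒[k+1][1+r][2+r]≤[k+3]r² k 3[k+1]≤r) ⟩
      r ℕ.* ((k ℕ.+ 3) ℕ.* (r ℕ.* r))                  ≡⟨ identity₂ r (k ℕ.+ 3) (r ℕ.* r) ⟩
      (k ℕ.+ 3) ℕ.* (r ℕ.* (r ℕ.* r))                  ≡⟨ cong ((k ℕ.+ 3) ℕ.*_) q≡ ⟨
      (k ℕ.+ 3) ℕ.* q                                  ∎
      where
      open ℕ.≤-Reasoning
      identity₁ : ∀ k d → 2 ℕ.* (k ℕ.+ 1) ℕ.* d ≡ (k ℕ.+ 1) ℕ.* (2 ℕ.* d)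
      identity₁ = ℕ-Solver.solve-∀
      identity₂ : ∀ x y z → x ℕ.* (y ℕ.* z) ≡ y ℕ.* (x ℕ.* z)
      identity₂ = ℕ-Solver.solve-∀

-- Assembly of the family.

open import Data.Nat using (_^_; _*_; _+_; _<_; _≤_)

theorem2 : (p : ℕ) → Prime p →
    Σ (ℕ → Set) λ Q →
    (∀ q → Q q → ∃ λ k → q ≡ p ^ k) ×
    (∀ N → ∃ λ q → N < q × Q q) ×
    Σ ((q : ℕ) → Q q → (F : FiniteField q) → List (FiniteField.Carrier F × FiniteField.Carrier F)) λ E →
    (∀ q (qQ : Q q) (F : FiniteField q) →
    Unique (E q qQ F) ×
    length (E q qQ F) ^ 3 ≡ q ^ 4 ×
    ¬ (∀ d → d ∈ FiniteField.Δ F (E q qQ F))) ×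
    (∀ k → ∃ λ N → ∀ q (qQ : Q q) (F : FiniteField q) → N ≤ q →
    2 * (k + 1) * FiniteField.∣Δ∣ F (E q qQ F) ≤ (k + 3) * q)
theorem2 p p-prime =
  (λ q → ∃ λ m → q ≡ rootOrder m * (rootOrder m * rootOrder m)) ,
  (λ q (m , q≡) → (let 2n = suc m + suc m in 2n + (2n + 2n)) , trans q≡ (rootOrder³≡p^ m)) ,
  -- The index N itself already gives N < r ≤ q.
  (λ N → _ , N<r³ N , N , refl) ,
  (λ q (m , q≡) F → square F m q≡) ,
  (λ q (m , q≡) F → square-Unique F m q≡ , length-square³≡q⁴ F m q≡ , Δ≢everything F m q≡) ,
  -- The threshold is the cube of 3(k+1), so that N ≤ q = r³ yields 3(k+1) ≤ r.
  (λ k → 3 * (k + 1) * (3 * (k + 1) * (3 * (k + 1))) , λ q (m , q≡) F N≤q →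
    ∣Δ∣-asymptotic F m q≡ k (cube-cancel-≤ _ _ (subst (_ ≤_) q≡ N≤q)))
  where
  open Construction p-prime
  N<r³ : ∀ N → N < rootOrder N * (rootOrder N * rootOrder N)
  N<r³ N = ℕ.<-≤-trans (ℕ.<-trans (ℕ.n<1+n N) (1+m<rootOrder N))
    (ℕ.m≤m*n (rootOrder N) _ {{ℕ.m*n≢0 (rootOrder N) (rootOrder N)}})
    where
    instance
      _ = ℕ.>-nonZero (ℕ.<-trans (s≤s z≤n) (1+m<rootOrder N))
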